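{- For every integer $d \geq 1$, let $i(d)$ denote the maximum number of edges of an invertibility critical hypergraph of degree $d$. Then $$3 \cdot 2^{d-2} - 2 \leq i(d) \leq (d-1)\binom{2d-1}{d} + 1.$$
   Context: A hypergraph $\mathbf{H} = (\mathcal{H}, V)$ consists of a finite vertex set $V$ and a family $\mathcal{H}$ of subsets of $V$ (the edges). $\mathbf{H}$ is invertible iff there exists a permutation $\pi$ of $V$ such that $\pi(E) \cap E = \emptyset$ for all $E \in \mathcal{H}$, where $\pi(E) = \{\pi(x) \mid x \in E\}$. $\mathbf{H}$ is invertibility critical iff $\mathbf{H}$ is not invertible but for every $E \in \mathcal{H}$ the hypergraph $(\mathcal{H} \setminus \{E\}, V)$ is invertible. For $x \in V$, the degree of $x$ is $|\{E \in \mathcal{H} \mid x \in E\}|$; $\mathbf{H}$ is of degree $d$ if every vertex has degree at most $d$. -}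

module Defs where

open import Data.Nat using (ℕ; _≤_)
open import Data.Fin using (Fin)
open import Data.Fin.Subset using (Subset; _∈_; _∉_)
open import Data.Fin.Subset.Properties using (_∈?_)
open import Data.Fin.Permutation using (Permutation′; _⟨$⟩ʳ_)
open import Data.List using (length; filter; allFin)
open import Data.Product using (Σ; _×_)
open import Relation.Nullary using (¬_)
open import Relation.Binary.PropositionalEquality using (_≡_)
open import Function.Definitions using (Injective)

-- A hypergraph on the finite vertex set V = Fin n, with m edges given by
-- an injective family (so the edges form a *set* of subsets of V).
record Hypergraph : Set where
  field
    n     : ℕ
    m     : ℕ
    edge  : Fin m → Subset n
    edge-injective : Injective _≡_ _≡_ edge
open Hypergraph public

edgeCount : Hypergraph → ℕ
edgeCount H = m H

InvertibleOn : (H : Hypergraph) → (Fin (m H) → Set) → Set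
InvertibleOn H P =
  Σ (Permutation′ (n H)) λ π →
    ∀ i → P i → ∀ x → x ∈ edge H i → (π ⟨$⟩ʳ x) ∉ edge H i

Invertible : Hypergraph → Set
Invertible H = InvertibleOn H (λ _ → ⊤′)
  where
  open import Data.Unit using () renaming (⊤ to ⊤′)

InvertibleWithout : (H : Hypergraph) → Fin (m H) → Set
InvertibleWithout H j = InvertibleOn H (λ i → ¬ (i ≡ j))

InvertibilityCritical : Hypergraph → Set
InvertibilityCritical H = ¬ Invertible H × (∀ j → InvertibleWithout H j)

degree : (H : Hypergraph) → Fin (n H) → ℕ
degree H x = length (filter (λ i → x ∈? edge H i) (allFin (m H)))

OfDegree : ℕ → Hypergraph → Set
OfDegree d H = ∀ x → degree H x ≤ d

-- Upper bound.  By Hall's theorem a non-invertible hypergraph has vertex sets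
-- A, B with |A| + |B| > |V| such that every a ∈ A and b ∈ B share an edge; in
-- particular A and B have a common vertex o.  Write S v for the set of edges
-- through v, so |S v| ≤ d.  Criticality gives for each edge p some a ∈ A, b ∈ B
-- with S a ∩ S b = {p}.  Let U ⊆ B be minimal such that b can be found in U for
-- every p outside S o.  Minimality yields for b ∈ U such a p_b and a_b with
-- S a_b ∩ S b′ ≠ {p_b} for the other b′ ∈ U, so the pairs (S a_b ∖ p_b , S b)
-- together with the pair (complement of S o , S o) satisfy the hypotheses of
-- Bollobás' set-pair inequality; the extra pair makes it strict and
-- |U| < C(2d−1, d).  Each S b with b ∈ U meets S o, and these sets and S o cover
-- all edges, hence their number is at most d + (d−1)|U|.
--
-- Lower bound.  An intersecting family of sets of size at most d in which every
-- point is the sole intersection of two members yields a critical hypergraph: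
-- take the members as vertices, the points as edges, and one isolated vertex
-- fewer than there are members.  Such a family on 3·2^(d−2) points is made of
-- two cross-intersecting families, built by doubling.

module Submission where

open import Defs
open import Data.Nat using (ℕ; _≤_; _+_; _*_; _∸_; _^_)
open import Data.Nat.Combinatorics using (_C_)
open import Data.Product using (Σ; _×_)

open import Data.Bool using (Bool; true; false; not; _∧_; _∨_; _xor_; if_then_else_)
import Data.Bool.Properties as Bool
open import Data.Empty using (⊥; ⊥-elim)
open import Data.Fin using (Fin; zero; suc; punchIn; punchOut; splitAt; join; _↑ˡ_; _↑ʳ_)
open import Data.Fin.Permutation using (Permutation′; permutation; _⟨$⟩ʳ_) renaming (id to idₚ)
open import Data.Fin.Properties using (any?; all?; ¬∀⟶∃¬; punchIn-punchOut; punchOut-punchIn; punchInᵢ≢i; punchOut-cong; splitAt⁻¹-↑ʳ; splitAt⁻¹-↑ˡ; splitAt-join; join-splitAt; ↑ˡ-injective; injective⇒≤; 1↔⊤; 2↔Bool; +↔⊎; *↔×) renaming (_≟_ to _≟ᶠ_)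
open import Data.Fin.Subset using (Subset)
open import Data.Fin.Subset.Properties using (anySubset?) renaming (_∈?_ to _∈ˢ?_)
open import Data.List using (List; []; _∷_; map; length; filter; allFin; tabulate; cartesianProduct)
import Data.List.Membership.DecPropositional as DecMembership
open import Data.List.Membership.Propositional using (_∈_)
open import Data.List.Membership.Propositional.Properties using (∈-allFin; ∈-cartesianProduct⁺; ∈-filter⁺; ∈-map⁺; ∈-map⁻)
open import Data.List.Properties using (length-map; map-∘)
open import Data.List.Relation.Unary.All using (All; []; _∷_)
import Data.List.Relation.Unary.All as All
import Data.List.Relation.Unary.All.Properties as All
open import Data.List.Relation.Unary.AllPairs using (AllPairs; []; _∷_)
import Data.List.Relation.Unary.AllPairs.Properties as AllPairs
import Data.List.Relation.Unary.Any as Any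
open import Data.List.Relation.Unary.Any using (here; there)
open import Data.List.Relation.Unary.Unique.Propositional using (Unique)
open import Data.List.Relation.Unary.Unique.Propositional.Properties using (allFin⁺; filter⁺)
open import Data.Nat using (zero; suc; _<_; _≤′_; ≤′-reflexive; ≤′-step; z≤n; s≤s; _!; >-nonZero)
open import Data.Nat.Combinatorics using (nCk+nC[k+1]≡[n+1]C[k+1]; k![n∸k]!∣n!)
open import Data.Nat.Combinatorics.Specification using (nCk≡n!/k![n-k]!)
open import Data.Nat.DivMod using (m/n*n≡m)
open import Data.Nat.ListAction using () renaming (sum to sumᴸ)
open import Data.Nat.Properties
open import Data.Nat.Tactic.RingSolver using (solve-∀)
open import Data.Product using (∃; ∃₂; _,_; proj₁; proj₂)
open import Data.Product.Function.NonDependent.Propositional using (_×-↔_)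
open import Data.Product.Properties using (≡-dec)
open import Data.Sum using (_⊎_; inj₁; inj₂; [_,_]′)
open import Data.Sum.Function.Propositional using (_⊎-↔_)
open import Data.Unit using (⊤; tt)
import Data.Vec as Vec
open import Data.Vec using (lookup)
open import Data.Vec.Properties using ([]=⇒lookup; lookup⇒[]=; lookup∘tabulate)
open import Function using (_∘_; _↔_; Inverse; Injection)
open import Function.Properties.Inverse using (↔-trans; Inverse⇒Injection)
open import Relation.Binary using (DecidableEquality)
open import Relation.Binary.PropositionalEquality
open import Relation.Nullary using (¬_; Dec; yes; no; does; contradiction)
open import Relation.Nullary.Decidable using (map′; _×-dec_; _→-dec_; ¬?; decidable-stable; dec-true; dec-false)
open import Relation.Unary using (Decidable)
open import Algebra.Properties.Semiring.Sum +-*-semiring using (sum; sum-cong-≗; sum-remove; sum-permute; ∑-distrib-+; *-distribˡ-sum; *-distribʳ-sum; sum-syntax; sum-replicate-zero)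

private variable
  k l : ℕ
  X : Set

-- Hall's theorem

infix 4 _⊑_

_⊑_ : (X → Bool) → (X → Bool) → Set
f ⊑ g = ∀ x → f x ≡ true → g x ≡ true

true≢false : true ≢ false
true≢false ()

⟦_⟧ : Bool → ℕ
⟦ true ⟧  = 1
⟦ false ⟧ = 0

# : (Fin k → Bool) → ℕ
# {k} f = ∑[ x < k ] ⟦ f x ⟧

∑-mono : {f g : Fin k → ℕ} → (∀ x → f x ≤ g x) → sum f ≤ sum g
∑-mono {zero}  f≤g = z≤n
∑-mono {suc k} f≤g = +-mono-≤ (f≤g zero) (∑-mono (f≤g ∘ suc))

∑-const : ∀ k c → ∑[ x < k ] c ≡ k * c
∑-const zero    c = refl
∑-const (suc k) c = cong (c +_) (∑-const k c)

#-true : ∀ k → # {k} (λ _ → true) ≡ k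
#-true k = trans (∑-const k 1) (*-identityʳ k)

#-mono : {f g : Fin k → Bool} → f ⊑ g → # f ≤ # g
#-mono {f = f} {g} f⊑g = ∑-mono λ x → lemma (f x) (g x) (f⊑g x)
  where
  lemma : ∀ a b → (a ≡ true → b ≡ true) → ⟦ a ⟧ ≤ ⟦ b ⟧
  lemma false b _ = z≤n
  lemma true  b h rewrite h refl = ≤-refl

#-∪-∩ : (f g : Fin k → Bool) → # (λ x → f x ∨ g x) + # (λ x → f x ∧ g x) ≡ # f + # g
#-∪-∩ f g = begin
  # (λ x → f x ∨ g x) + # (λ x → f x ∧ g x)   ≡⟨ ∑-distrib-+ (λ x → ⟦ f x ∨ g x ⟧) _ ⟨
  ∑[ x < _ ] (⟦ f x ∨ g x ⟧ + ⟦ f x ∧ g x ⟧)  ≡⟨ sum-cong-≗ (λ x → lemma (f x) (g x)) ⟩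
  ∑[ x < _ ] (⟦ f x ⟧ + ⟦ g x ⟧)              ≡⟨ ∑-distrib-+ (⟦_⟧ ∘ f) (⟦_⟧ ∘ g) ⟩
  # f + # g                                   ∎
  where
  open ≡-Reasoning
  lemma : ∀ a b → ⟦ a ∨ b ⟧ + ⟦ a ∧ b ⟧ ≡ ⟦ a ⟧ + ⟦ b ⟧
  lemma true  true  = refl
  lemma true  false = refl
  lemma false true  = refl
  lemma false false = refl

#-remove : (f : Fin (suc k) → Bool) (x : Fin (suc k)) → # f ≡ ⟦ f x ⟧ + # (f ∘ punchIn x)
#-remove f x = sum-remove {i = x} (⟦_⟧ ∘ f)

∑-zero : {f : Fin k → ℕ} → (∀ x → f x ≡ 0) → sum f ≡ 0
∑-zero {k} f≡0 = trans (sum-cong-≗ f≡0) (sum-replicate-zero k)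

#-singleton : (x : Fin k) → # (λ y → does (y ≟ᶠ x)) ≡ 1
#-singleton {suc k} zero = cong suc (∑-zero {k} {λ _ → 0} λ _ → refl)
#-singleton (suc x) = #-singleton x

-- Deletion of points and minimal sets

module _ (_≟_ : DecidableEquality X) where

  erase : X → (X → Bool) → X → Bool
  erase x f y = if does (y ≟ x) then false else f y

  erase-≢ : ∀ {x y} f → y ≢ x → erase x f y ≡ f y
  erase-≢ {x} {y} f y≢x rewrite dec-false (y ≟ x) y≢x = refl

  erase⁻ : ∀ {x y} f → erase x f y ≡ true → y ≢ x × f y ≡ true
  erase⁻ {x} {y} f e with y ≟ x
  ... | no y≢x = y≢x , e

  erase-mono : ∀ {x f g} → f ⊑ g → erase x f ⊑ erase x g
  erase-mono {x} {f} {g} f⊑g y e =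
    let y≢x , fy = erase⁻ f e in trans (erase-≢ g y≢x) (f⊑g y fy)

  module _ {P : (X → Bool) → Set} (P? : Decidable P)
           (P-mono : ∀ {f g} → f ⊑ g → P f → P g) where

    -- One greedy pass suffices: if erasing `x` destroys `P` at its turn, then by monotonicity it
    -- still does so after all later deletions.
    minimise : ∀ xs f → P f → ∃ λ g → g ⊑ f × P g × (∀ {x} → x ∈ xs → g x ≡ true → ¬ P (erase x g))
    minimise []       f Pf = f , (λ _ e → e) , Pf , λ ()
    minimise (x ∷ xs) f Pf with P? (erase x f)
    ... | yes Pf⁻ =
      let g , g⊑ , Pg , min = minimise xs (erase x f) Pf⁻ in
      g , (λ y e → proj₂ (erase⁻ f (g⊑ y e))) , Pg ,
      λ { (here refl) e → contradiction refl (proj₁ (erase⁻ f (g⊑ x e)))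
        ; (there x∈)  e → min x∈ e }
    ... | no ¬Pf⁻ =
      let g , g⊑ , Pg , min = minimise xs f Pf in
      g , g⊑ , Pg ,
      λ { (here refl) e → ¬Pf⁻ ∘ P-mono (erase-mono g⊑)
        ; (there x∈)  e → min x∈ e }

#-erase : (f : Fin k → Bool) {x : Fin k} → f x ≡ true → suc (# (erase _≟ᶠ_ x f)) ≡ # f
#-erase f {x} fx = sym (begin
  # f                                                         ≡⟨ sum-cong-≗ split ⟩
  ∑[ y < _ ] (⟦ does (y ≟ᶠ x) ⟧ + ⟦ erase _≟ᶠ_ x f y ⟧)       ≡⟨ ∑-distrib-+ (λ y → ⟦ does (y ≟ᶠ x) ⟧) _ ⟩
  # (λ y → does (y ≟ᶠ x)) + # (erase _≟ᶠ_ x f)                ≡⟨ cong (_+ # (erase _≟ᶠ_ x f)) (#-singleton x) ⟩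
  suc (# (erase _≟ᶠ_ x f))                                    ∎)
  where
  open ≡-Reasoning
  split : ∀ y → ⟦ f y ⟧ ≡ ⟦ does (y ≟ᶠ x) ⟧ + ⟦ erase _≟ᶠ_ x f y ⟧
  split y with y ≟ᶠ x
  ... | yes refl = cong ⟦_⟧ fx
  ... | no _     = refl

-- Barriers and perfect matchings

Rel : ℕ → Set
Rel k = Fin k × Fin k → Bool

-- A violation of Hall's condition in symmetric form: all neighbours of `A` lie outside `B`, which
-- leaves fewer than `# A` of them.
IsBarrier : Rel k → (A B : Fin k → Bool) → Set
IsBarrier {k} R A B = k < # A + # B × (∀ x y → A x ≡ true → B y ≡ true → R (x , y) ≡ false)

Barrier : Rel k → Set
Barrier R = ∃₂ (IsBarrier R)

isBarrier? : (R : Rel k) → ∀ A B → Dec (IsBarrier R A B)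
isBarrier? R A B = (_ <? _) ×-dec all? λ x → all? λ y →
  (A x Bool.≟ true) →-dec ((B y Bool.≟ true) →-dec (R (x , y) Bool.≟ false))

IsBarrier-resp : ∀ {R : Rel k} {A A′ B B′} → A ≗ A′ → B ≗ B′ → IsBarrier R A B → IsBarrier R A′ B′
IsBarrier-resp {k} A≗ B≗ (size , empty) =
  subst (k <_) (cong₂ _+_ (sum-cong-≗ (cong ⟦_⟧ ∘ A≗)) (sum-cong-≗ (cong ⟦_⟧ ∘ B≗))) size ,
  λ x y ax by → empty x y (trans (A≗ x) ax) (trans (B≗ y) by)

barrier? : (R : Rel k) → Dec (Barrier R)
barrier? R =
  map′ (λ (A , B , bar) → lookup A , lookup B , bar)
       (λ (A , B , bar) → Vec.tabulate A , Vec.tabulate B ,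
          IsBarrier-resp {R = R} (sym ∘ lookup∘tabulate A) (sym ∘ lookup∘tabulate B) bar)
       (anySubset? λ A → anySubset? λ B → isBarrier? R (lookup A) (lookup B))

Barrier-anti : {R R′ : Rel k} → R ⊑ R′ → Barrier R′ → Barrier R
Barrier-anti R⊑R′ (A , B , size , empty) =
  A , B , size , λ x y ax by → Bool.¬-not λ r → true≢false (trans (sym (R⊑R′ _ r)) (empty x y ax by))

_≟²_ : DecidableEquality (Fin k × Fin k)
_≟²_ = ≡-dec _≟ᶠ_ _≟ᶠ_

∧-true : ∀ a b → a ∧ b ≡ true → a ≡ true × b ≡ true
∧-true true true e = refl , refl

∧-true⁺ : ∀ {a b} → a ≡ true → b ≡ true → a ∧ b ≡ true
∧-true⁺ refl refl = refl

-- A barrier of the smaller relation that misses row `x` or column `y` never inspects the erased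
-- pair, so it would be a barrier of `R`.
erase-barrier-∋ : ∀ {R : Rel k} {x y} → ¬ Barrier R → ∀ {A B} → IsBarrier (erase _≟²_ (x , y) R) A B →
                  A x ≡ true × B y ≡ true
erase-barrier-∋ {R = R} {x} {y} noBar {A} {B} (size , empty) with A x in ax | B y in by
... | true  | true = refl , refl
... | false | _    = ⊥-elim (noBar (A , B , size , λ u v au bv →
  trans (sym (erase-≢ _≟²_ R λ { refl → true≢false (trans (sym au) ax) })) (empty u v au bv)))
... | true | false = ⊥-elim (noBar (A , B , size , λ u v au bv →
  trans (sym (erase-≢ _≟²_ R λ { refl → true≢false (trans (sym bv) by) })) (empty u v au bv)))

-- Rado's argument: barriers for two deletions in the same row uncross to a
-- barrier for R itself.
row-unique : ∀ {R : Rel k} → ¬ Barrier R → ∀ {x y z} → y ≢ z →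
             Barrier (erase _≟²_ (x , y) R) → Barrier (erase _≟²_ (x , z) R) → ⊥
row-unique {k} {R} noBar {x} {y} {z} y≢z (A₁ , B₁ , bar₁@(size₁ , empty₁)) (A₂ , B₂ , bar₂@(size₂ , empty₂)) =
  -- The two barriers have total size at least 2k + 2. Deleting `x` from `A∩` costs one, so one of
  -- the uncrossed pairs (`A∪`, `B∩`) and (`A⁻`, `B∪`) still has size above `k`.
  1+n≰n {suc (k + k)} (begin
    suc (suc (k + k))                          ≡⟨ cong suc (+-suc k k) ⟨
    suc k + suc k                              ≤⟨ +-mono-≤ size₁ size₂ ⟩
    (# A₁ + # B₁) + (# A₂ + # B₂)              ≡⟨ swap (# A₁) _ _ _ ⟩
    (# A₁ + # A₂) + (# B₁ + # B₂)              ≡⟨ cong₂ _+_ (#-∪-∩ A₁ A₂) (#-∪-∩ B₁ B₂) ⟨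
    (# A∪ + # A∩) + (# B∪ + # B∩)              ≡⟨ cong (λ s → (# A∪ + s) + (# B∪ + # B∩)) (#-erase A∩ x∈A∩) ⟨
    (# A∪ + suc (# A⁻)) + (# B∪ + # B∩)        ≡⟨ regroup (# A∪) (# A⁻) _ _ ⟩
    suc ((# A∪ + # B∩) + (# A⁻ + # B∪))        ≤⟨ s≤s (+-mono-≤ (≮⇒≥ bound₁) (≮⇒≥ bound₂)) ⟩
    suc (k + k)                                ∎)
  where
  open ≤-Reasoning
  A∪ A∩ B∪ B∩ A⁻ : Fin k → Bool
  A∪ u = A₁ u ∨ A₂ u
  A∩ u = A₁ u ∧ A₂ u
  B∪ u = B₁ u ∨ B₂ u
  B∩ u = B₁ u ∧ B₂ u
  A⁻ = erase _≟ᶠ_ x A∩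
  swap : ∀ a b c d → (a + b) + (c + d) ≡ (a + c) + (b + d)
  swap = solve-∀
  regroup : ∀ a b c d → (a + suc b) + (c + d) ≡ suc ((a + d) + (b + c))
  regroup = solve-∀
  x∈₁ = erase-barrier-∋ noBar bar₁
  x∈₂ = erase-barrier-∋ noBar bar₂
  x∈A∩ : A∩ x ≡ true
  x∈A∩ = ∧-true⁺ (proj₁ x∈₁) (proj₁ x∈₂)
  only₁ : ∀ {u v} → A₁ u ≡ true → B₁ v ≡ true → R (u , v) ≡ true → (u , v) ≡ (x , y)
  only₁ au bv r = decidable-stable (_ ≟² _) λ ≢ →
    true≢false (trans (sym (trans (erase-≢ _≟²_ R ≢) r)) (empty₁ _ _ au bv))
  only₂ : ∀ {u v} → A₂ u ≡ true → B₂ v ≡ true → R (u , v) ≡ true → (u , v) ≡ (x , z)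
  only₂ au bv r = decidable-stable (_ ≟² _) λ ≢ →
    true≢false (trans (sym (trans (erase-≢ _≟²_ R ≢) r)) (empty₂ _ _ au bv))
  -- A pair of `R` in this rectangle is the erased pair of one barrier. Its row `x` lies in both row
  -- sets and its column in both column sets, so it is the erased pair of the other barrier too,
  -- which forces `y ≡ z`.
  bound₁ : ¬ (k < # A∪ + # B∩)
  bound₁ size = noBar (A∪ , B∩ , size , λ u v au bv → Bool.¬-not λ r → absurd u v au (∧-true (B₁ v) _ bv) r)
    where
    absurd : ∀ u v → A∪ u ≡ true → B₁ v ≡ true × B₂ v ≡ true → R (u , v) ≡ true → ⊥
    absurd u v au (b₁ , b₂) r with A₁ u in a₁
    ... | true with refl ← only₁ a₁ b₁ r = y≢z (cong proj₂ (only₂ (proj₁ x∈₂) b₂ r))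
    ... | false with refl ← only₂ au b₂ r = y≢z (sym (cong proj₂ (only₁ (proj₁ x∈₁) b₁ r)))
  -- Both erased pairs lie in row `x`, which `A⁻` avoids.
  bound₂ : ¬ (k < # A⁻ + # B∪)
  bound₂ size = noBar (A⁻ , B∪ , size , λ u v au bv → Bool.¬-not λ r →
    let u≢x , a = erase⁻ _≟ᶠ_ A∩ au in absurd u v u≢x (∧-true (A₁ u) _ a) bv r)
    where
    absurd : ∀ u v → u ≢ x → A₁ u ≡ true × A₂ u ≡ true → B∪ v ≡ true → R (u , v) ≡ true → ⊥
    absurd u v u≢x (a₁ , a₂) bv r with B₁ v in b₁
    ... | true  = u≢x (cong proj₁ (only₁ a₁ b₁ r))
    ... | false = u≢x (cong proj₁ (only₂ a₂ bv r))

-- A minimal barrier-free subrelation `M` is the graph of a permutation. Absence of barriers makes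
-- rows and columns nonempty and keeps two rows from sharing their entry; minimality with
-- `row-unique` leaves one entry per row.
hall : (R : Rel k) → ¬ Barrier R → ∃ λ (π : Permutation′ k) → ∀ x → R (x , π ⟨$⟩ʳ x) ≡ true
hall {k} R noBar with
  minimise _≟²_ (λ R → ¬? (barrier? R)) (λ f⊑g noBar → noBar ∘ Barrier-anti f⊑g)
           (cartesianProduct (allFin k) (allFin k)) R noBar
... | M , M⊑R , noBarM , min =
  permutation to from (λ y → unique (M-to (from y)) (M-from y)) (λ x → to-injective (unique (M-to _) (M-from (to x)))) ,
  λ x → M⊑R _ (M-to x)
  where
  only : Fin k → Fin k → Bool
  only x y = does (y ≟ᶠ x)

  only-true : ∀ {x y} → only x y ≡ true → y ≡ x
  only-true {x} {y} e with y ≟ᶠ x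
  ... | yes y≡x = y≡x

  size : ∀ x → k < # (only x) + # {k} (λ _ → true)
  size x = ≤-reflexive (sym (cong₂ _+_ (#-singleton x) (#-true k)))

  image : ∀ x → ∃ λ y → M (x , y) ≡ true
  image x = decidable-stable (any? λ y → M (x , y) Bool.≟ true) λ none →
    noBarM (only x , _ , size x , λ u v au _ → Bool.¬-not λ r →
      none (v , subst (λ u → M (u , v) ≡ true) (only-true au) r))

  preimage : ∀ y → ∃ λ x → M (x , y) ≡ true
  preimage y = decidable-stable (any? λ x → M (x , y) Bool.≟ true) λ none →
    noBarM (_ , only y , subst (k <_) (+-comm (# (only y)) _) (size y) , λ u v _ bv → Bool.¬-not λ r →
      none (u , subst (λ v → M (u , v) ≡ true) (only-true bv) r))

  to from : Fin k → Fin k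
  to   = proj₁ ∘ image
  from = proj₁ ∘ preimage
  M-to : ∀ x → M (x , to x) ≡ true
  M-to = proj₂ ∘ image
  M-from : ∀ y → M (from y , y) ≡ true
  M-from = proj₂ ∘ preimage

  critical : ∀ {x y} → M (x , y) ≡ true → Barrier (erase _≟²_ (x , y) M)
  critical e = decidable-stable (barrier? _) (min (∈-cartesianProduct⁺ (∈-allFin _) (∈-allFin _)) e)

  unique : ∀ {x y z} → M (x , y) ≡ true → M (x , z) ≡ true → y ≡ z
  unique r s = decidable-stable (_ ≟ᶠ _) λ y≢z → row-unique noBarM y≢z (critical r) (critical s)

  to-injective : ∀ {x x′} → to x ≡ to x′ → x ≡ x′
  to-injective {x} {x′} eq = decidable-stable (x ≟ᶠ x′) λ x≢x′ →
    -- Two rows against all columns but their common one: 2 + (k ∸ 1) exceeds `k`.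
    noBarM (pair , others , pair-size x≢x′ , λ u v au bv → Bool.¬-not λ r →
      proj₁ (erase⁻ _≟ᶠ_ (λ _ → true) bv) (trans (unique r (M-to u)) (to-pair u au)))
    where
    pair others : Fin k → Bool
    pair u = only x u ∨ only x′ u
    others = erase _≟ᶠ_ (to x) (λ _ → true)
    to-pair : ∀ u → pair u ≡ true → to u ≡ to x
    to-pair u au with u ≟ᶠ x
    ... | yes u≡x = cong to u≡x
    ... | no _    = trans (cong to (only-true au)) (sym eq)
    pair-size : x ≢ x′ → k < # pair + # others
    pair-size x≢x′ = begin-strict
      k                                                     <⟨ n<1+n k ⟩
      suc k                                                 ≡⟨ cong suc (#-true k) ⟨
      suc (# {k} (λ _ → true))                              ≡⟨ cong suc (#-erase {k} (λ _ → true) refl) ⟨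
      2 + # others                                          ≡⟨ cong (_+ # others) (cong₂ _+_ (#-singleton x) (#-singleton x′)) ⟨
      (# (only x) + # (only x′)) + # others                 ≡⟨ cong (_+ # others) (#-∪-∩ (only x) (only x′)) ⟨
      (# pair + # (λ u → only x u ∧ only x′ u)) + # others  ≡⟨ cong (λ s → (# pair + s) + # others) (∑-zero disjoint) ⟩
      (# pair + 0) + # others                               ≡⟨ cong (_+ # others) (+-identityʳ _) ⟩
      # pair + # others                                     ∎
      where
      open ≤-Reasoning
      disjoint : ∀ u → ⟦ only x u ∧ only x′ u ⟧ ≡ 0
      disjoint u with u ≟ᶠ x | u ≟ᶠ x′
      ... | yes refl | yes refl = contradiction refl x≢x′
      ... | yes _    | no _     = refl
      ... | no _     | _        = refl

-- `A` and the preimage of `B` under `π` have total size above `k`, so they overlap. This serves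
-- twice: with the identity for the common vertex `o`, and with the permutation that inverts a
-- hypergraph short of one edge.
permutation-meets : ∀ (π : Permutation′ k) {A B : Fin k → Bool} → k < # A + # B →
                    ∃ λ x → A x ≡ true × B (π ⟨$⟩ʳ x) ≡ true
permutation-meets {k} π {A} {B} size =
  decidable-stable (any? λ x → (A x Bool.≟ true) ×-dec (B (π ⟨$⟩ʳ x) Bool.≟ true)) λ none →
    <⇒≱ size (begin
      # A + # B                                ≡⟨ cong (# A +_) (sum-permute (⟦_⟧ ∘ B) π) ⟩
      # A + # (B ∘ (π ⟨$⟩ʳ_))                  ≡⟨ ∑-distrib-+ (⟦_⟧ ∘ A) _ ⟨
      ∑[ x < k ] (⟦ A x ⟧ + ⟦ B (π ⟨$⟩ʳ x) ⟧)  ≤⟨ ∑-mono (λ x → lemma (A x) _ λ a b → none (x , a , b)) ⟩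
      ∑[ x < k ] 1                             ≡⟨ #-true k ⟩
      k                                        ∎)
  where
  open ≤-Reasoning
  lemma : ∀ a b → (a ≡ true → b ≡ true → ⊥) → ⟦ a ⟧ + ⟦ b ⟧ ≤ 1
  lemma true  true  h = ⊥-elim (h refl refl)
  lemma true  false h = ≤-refl
  lemma false true  h = ≤-refl
  lemma false false h = z≤n

-- Bollobás' inequality

Meet Disjoint : (f g : X → Bool) → Set
Meet f g = ∃ λ x → f x ≡ true × g x ≡ true
Disjoint f g = ∀ x → f x ≡ true → g x ≡ false

-- The number of linear orders of Fin k in which A entirely precedes B,
-- computed by the choice of the first element.
orders : (A B : Fin k → Bool) → ℕ
orders {zero}  A B = 1
orders {suc k} A B with any? (λ x → A x Bool.≟ true)
... | no _  = suc k !
... | yes _ = ∑[ x < suc k ] (if B x then 0 else orders (A ∘ punchIn x) (B ∘ punchIn x))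

orders-∃ : (A B : Fin (suc k) → Bool) → (∃ λ x → A x ≡ true) →
           orders A B ≡ ∑[ x < suc k ] (if B x then 0 else orders (A ∘ punchIn x) (B ∘ punchIn x))
orders-∃ A B ne with any? (λ x → A x Bool.≟ true)
... | yes _ = refl
... | no ¬ne = contradiction ne ¬ne

orders≤n! : (A B : Fin k → Bool) → orders A B ≤ k !
orders≤n! {zero}  A B = ≤-refl
orders≤n! {suc k} A B with any? (λ x → A x Bool.≟ true)
... | no _  = ≤-refl
... | yes _ = begin
  ∑[ x < suc k ] (if B x then 0 else orders (A ∘ punchIn x) (B ∘ punchIn x))  ≤⟨ ∑-mono bound ⟩
  ∑[ x < suc k ] (k !)                                                        ≡⟨ ∑-const (suc k) (k !) ⟩
  suc k !                                                                     ∎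
  where
  open ≤-Reasoning
  bound : ∀ x → (if B x then 0 else orders (A ∘ punchIn x) (B ∘ punchIn x)) ≤ k !
  bound x with B x
  ... | true  = z≤n
  ... | false = orders≤n! (A ∘ punchIn x) (B ∘ punchIn x)

#-empty : {f : Fin k → Bool} → ¬ (∃ λ x → f x ≡ true) → # f ≡ 0
#-empty none = ∑-zero λ x → cong ⟦_⟧ (Bool.¬-not λ e → none (x , e))

#-remove-true : (f : Fin (suc k) → Bool) {x : Fin (suc k)} → f x ≡ true → # f ≡ suc (# (f ∘ punchIn x))
#-remove-true f {x} fx = trans (#-remove f x) (cong (λ b → ⟦ b ⟧ + # (f ∘ punchIn x)) fx)

#-remove-false : (f : Fin (suc k) → Bool) {x : Fin (suc k)} → f x ≡ false → # f ≡ # (f ∘ punchIn x)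
#-remove-false f {x} fx = trans (#-remove f x) (cong (λ b → ⟦ b ⟧ + # (f ∘ punchIn x)) fx)

-- Only the relative order of the c + b elements of `A` and `B` matters, and c! b! of its (c + b)!
-- possibilities put `A` first. The identity is cleared of denominators and proved by conditioning
-- on the first element.
orders-count : ∀ {k c b} (A B : Fin k → Bool) → Disjoint A B → # A ≡ c → # B ≡ b →
               orders A B * (c + b) ! ≡ k ! * (c ! * b !)
orders-count {zero} A B A⊥B refl refl = refl
orders-count {suc k} {c} {b} A B A⊥B #A #B with any? (λ x → A x Bool.≟ true)
... | no none rewrite trans (sym #A) (#-empty none) | *-identityˡ (b !) = refl
... | yes (x₀ , Ax₀) with refl ← trans (sym #A) (#-remove-true A Ax₀) = begin
  sum t * N !                                 ≡⟨ *-distribʳ-sum (N !) t ⟩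
  ∑[ x < suc k ] (t x * N !)                  ≡⟨ sum-cong-≗ term ⟩
  ∑[ x < suc k ] (K * w x)                    ≡⟨ *-distribˡ-sum K w ⟨
  K * sum w                                   ≡⟨ cong (K *_) total ⟩
  K * (suc k * suc a)                         ≡⟨ regroup (k !) (a !) (b !) k a ⟩
  suc k ! * (suc a ! * b !)                   ∎
  where
  open ≡-Reasoning
  a = # (A ∘ punchIn x₀)
  N = suc a + b
  K = k ! * (a ! * b !)
  t w : Fin (suc k) → ℕ
  t x = if B x then 0 else orders (A ∘ punchIn x) (B ∘ punchIn x)
  -- The contribution of first element `x` after the common factor `K` is taken out: a first element
  -- in `A` uses up one element of `A`, one outside both sets changes neither size.
  w x = if B x then 0 else (if A x then N else suc a)
  regroup : ∀ f g h k a → (f * (g * h)) * (suc k * suc a) ≡ (suc k * f) * ((suc a * g) * h)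
  regroup = solve-∀
  term : ∀ x → t x * N ! ≡ K * w x
  term x with B x in bx | A x in cx
  ... | true  | _     = sym (*-zeroʳ K)
  ... | false | true  = begin
    o * (N * (a + b) !)   ≡⟨ swap o N _ ⟩
    o * (a + b) ! * N     ≡⟨ cong (_* N) (orders-count _ _ (λ y → A⊥B (punchIn x y))
                               (suc-injective (trans (sym (#-remove-true A cx)) #A))
                               (trans (sym (#-remove-false B bx)) #B)) ⟩
    K * N                 ∎
    where
    o = orders (A ∘ punchIn x) (B ∘ punchIn x)
    swap : ∀ o s t → o * (s * t) ≡ o * t * s
    swap = solve-∀
  ... | false | false = begin
    orders (A ∘ punchIn x) (B ∘ punchIn x) * N !  ≡⟨ orders-count _ _ (λ y → A⊥B (punchIn x y))
                                                        (trans (sym (#-remove-false A cx)) #A)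
                                                        (trans (sym (#-remove-false B bx)) #B) ⟩
    k ! * (suc a ! * b !)                         ≡⟨ swap (k !) (a !) (b !) (suc a) ⟩
    K * suc a                                     ∎
    where
    swap : ∀ f g h s → f * ((s * g) * h) ≡ (f * (g * h)) * s
    swap = solve-∀
  total : sum w ≡ suc k * suc a
  -- Adding `b * suc a` to both sides avoids subtraction: with the excluded elements of `B`
  -- refilled, every `x` weighs `suc a`, and those of `A` carry `b` more.
  total = +-cancelʳ-≡ (b * suc a) (sum w) (suc k * suc a) (begin
    sum w + b * suc a                                 ≡⟨ cong (λ b → sum w + b * suc a) #B ⟨
    sum w + # B * suc a                               ≡⟨ cong (sum w +_) (*-distribʳ-sum (suc a) (⟦_⟧ ∘ B)) ⟩
    sum w + ∑[ x < suc k ] (⟦ B x ⟧ * suc a)          ≡⟨ ∑-distrib-+ w (λ x → ⟦ B x ⟧ * suc a) ⟨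
    ∑[ x < suc k ] (w x + ⟦ B x ⟧ * suc a)            ≡⟨ sum-cong-≗ balance ⟩
    ∑[ x < suc k ] (suc a + ⟦ A x ⟧ * b)              ≡⟨ ∑-distrib-+ (λ _ → suc a) (λ x → ⟦ A x ⟧ * b) ⟩
    ∑[ x < suc k ] suc a + ∑[ x < suc k ] (⟦ A x ⟧ * b)
                                                      ≡⟨ cong₂ _+_ (∑-const (suc k) (suc a)) (sym (*-distribʳ-sum b (⟦_⟧ ∘ A))) ⟩
    suc k * suc a + # A * b                           ≡⟨ cong (λ c → suc k * suc a + c * b) #A ⟩
    suc k * suc a + suc a * b                         ≡⟨ cong (suc k * suc a +_) (*-comm (suc a) b) ⟩
    suc k * suc a + b * suc a                         ∎)
    where
    balance : ∀ x → w x + ⟦ B x ⟧ * suc a ≡ suc a + ⟦ A x ⟧ * b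
    balance x with B x in bx | A x in cx
    ... | true  | true  = contradiction (trans (sym bx) (A⊥B x cx)) true≢false
    ... | true  | false = refl
    ... | false | true  = trans (+-identityʳ N) (cong (suc a +_) (sym (+-identityʳ b)))
    ... | false | false = refl

-- Binomial coefficients

[c+b]C[b]*c!*b! : ∀ c b → ((c + b) C b) * (c ! * b !) ≡ (c + b) !
[c+b]C[b]*c!*b! c b = begin
  ((c + b) C b) * (c ! * b !)            ≡⟨ cong (((c + b) C b) *_) (trans (*-comm (c !) (b !)) (cong (λ e → b ! * e !) (sym (m+n∸n≡m c b)))) ⟩
  ((c + b) C b) * (b ! * (c + b ∸ b) !)  ≡⟨ cong (_* (b ! * (c + b ∸ b) !)) (nCk≡n!/k![n-k]! (m≤n+m b c)) ⟩
  _                                      ≡⟨ m/n*n≡m {{b !* (c + b ∸ b) !≢0}} (k![n∸k]!∣n! (m≤n+m b c)) ⟩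
  (c + b) !                              ∎
  where open ≡-Reasoning

nCk≤[1+n]Ck : ∀ k j → k C j ≤ suc k C j
nCk≤[1+n]Ck k zero    = ≤-refl
nCk≤[1+n]Ck k (suc j) = ≤-trans (m≤n+m _ (k C j)) (≤-reflexive (nCk+nC[k+1]≡[n+1]C[k+1] k j))

nCk≤[1+n]C[1+k] : ∀ k j → k C j ≤ suc k C suc j
nCk≤[1+n]C[1+k] k j = ≤-trans (m≤m+n _ _) (≤-reflexive (nCk+nC[k+1]≡[n+1]C[k+1] k j))

[c+b]C[b]-mono : ∀ {c c′ b b′} → c ≤ c′ → b ≤ b′ → (c + b) C b ≤ (c′ + b′) C b′
[c+b]C[b]-mono {c} {c′} {b} {b′} c≤c′ b≤b′ = ≤-trans (left (≤⇒≤′ c≤c′)) (right (≤⇒≤′ b≤b′))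
  where
  left : ∀ {c′} → c ≤′ c′ → (c + b) C b ≤ (c′ + b) C b
  left (≤′-reflexive refl) = ≤-refl
  left (≤′-step p)         = ≤-trans (left p) (nCk≤[1+n]Ck _ b)
  right : ∀ {b′} → b ≤′ b′ → (c′ + b) C b ≤ (c′ + b′) C b′
  right (≤′-reflexive refl) = ≤-refl
  right (≤′-step {b′} p)    = ≤-trans (right p) (≤-trans (nCk≤[1+n]C[1+k] _ b′) (≤-reflexive (cong (_C suc b′) (sym (+-suc c′ b′)))))

-- By `orders-count` a zero count would make a product of factorials vanish. This one order is what
-- the extra pair (complement of `S o`, `S o`) contributes to the strict inequality.
orders-positive : (A B : Fin k → Bool) → Disjoint A B → 1 ≤ orders A B
orders-positive {k} A B A⊥B with orders A B | orders-count A B A⊥B refl refl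
... | suc o | _  = s≤s z≤n
... | zero  | eq = contradiction eq (<⇒≢ (*-mono-< (1≤n! k) (*-mono-< (1≤n! (# A)) (1≤n! (# B)))))

n!≤orders*binomial : ∀ {a b} (A B : Fin k → Bool) → Disjoint A B → # A ≤ a → # B ≤ b →
                     k ! ≤ orders A B * ((a + b) C b)
n!≤orders*binomial {k} {a} {b} A B A⊥B A≤a B≤b = ≤-trans (≤-reflexive exact) (*-monoʳ-≤ (orders A B) ([c+b]C[b]-mono A≤a B≤b))
  where
  open ≡-Reasoning
  F = # A ! * # B !
  exact : k ! ≡ orders A B * ((# A + # B) C # B)
  exact = *-cancelʳ-≡ _ _ F {{# A !* # B !≢0}} (begin
    k ! * F                                        ≡⟨ orders-count A B A⊥B refl refl ⟨
    orders A B * (# A + # B) !                     ≡⟨ cong (orders A B *_) ([c+b]C[b]*c!*b! (# A) (# B)) ⟨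
    orders A B * (((# A + # B) C # B) * F)         ≡⟨ *-assoc (orders A B) _ F ⟨
    orders A B * ((# A + # B) C # B) * F           ∎)

-- Families of cross-intersecting set pairs

SetPair : ℕ → Set
SetPair k = (Fin k → Bool) × (Fin k → Bool)

-- Symmetric because `AllPairs` compares any two members in one order only.
Cross : SetPair k → SetPair k → Set
Cross (A , B) (A′ , B′) = Meet A B′ × Meet A′ B

totalOrders : List (SetPair k) → ℕ
totalOrders L = sumᴸ (map (λ (A , B) → orders A B) L)

-- Conditions on `x` being first in the order: a pair with nonempty first set is lost if `x` is in
-- its second set, and otherwise continues on the remaining points.
restrict : Fin (suc k) → List (SetPair (suc k)) → List (SetPair k)
restrict x []            = []
restrict x ((A , B) ∷ L) =
  if B x then restrict x L else ((A ∘ punchIn x , B ∘ punchIn x) ∷ restrict x L)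

Meet-punchIn : ∀ {f g : Fin (suc k) → Bool} {x} → g x ≡ false → Meet f g → Meet (f ∘ punchIn x) (g ∘ punchIn x)
Meet-punchIn {f = f} {g} {x} gx (y , fy , gy) =
  punchOut x≢y , trans (cong f (punchIn-punchOut x≢y)) fy , trans (cong g (punchIn-punchOut x≢y)) gy
  where
  x≢y : x ≢ y
  x≢y refl = true≢false (trans (sym gy) gx)

restrict-cross : ∀ {x} {L : List (SetPair (suc k))} → AllPairs Cross L → AllPairs Cross (restrict x L)
restrict-cross [] = []
restrict-cross {x = x} {(A , B) ∷ L} (p ∷ ps) with B x in bx
... | true  = restrict-cross ps
... | false = heads p ∷ restrict-cross ps
  where
  heads : ∀ {L} → All (Cross (A , B)) L → All (Cross (A ∘ punchIn x , B ∘ punchIn x)) (restrict x L)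
  heads [] = []
  heads {(A′ , B′) ∷ L} ((m , m′) ∷ hs) with B′ x in bx′
  ... | true  = heads hs
  ... | false = (Meet-punchIn bx′ m , Meet-punchIn bx m′) ∷ heads hs

totalOrders-restrict : ∀ {L : List (SetPair (suc k))} → All (λ (A , B) → ∃ λ x → A x ≡ true) L →
                       totalOrders L ≡ ∑[ x < suc k ] totalOrders (restrict x L)
totalOrders-restrict {k} [] = sym (∑-zero {suc k} {λ _ → 0} λ _ → refl)
totalOrders-restrict {k} {(A , B) ∷ L} (ne ∷ nes) = begin
  orders A B + totalOrders L                                              ≡⟨ cong₂ _+_ (orders-∃ A B ne) (totalOrders-restrict nes) ⟩
  sum t + ∑[ x < suc k ] totalOrders (restrict x L)                       ≡⟨ ∑-distrib-+ t (λ x → totalOrders (restrict x L)) ⟨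
  ∑[ x < suc k ] (t x + totalOrders (restrict x L))                       ≡⟨ sum-cong-≗ term ⟩
  ∑[ x < suc k ] totalOrders (restrict x ((A , B) ∷ L))                   ∎
  where
  open ≡-Reasoning
  t : Fin (suc k) → ℕ
  t x = if B x then 0 else orders (A ∘ punchIn x) (B ∘ punchIn x)
  term : ∀ x → t x + totalOrders (restrict x L) ≡ totalOrders (restrict x ((A , B) ∷ L))
  term x with B x
  ... | true  = refl
  ... | false = refl

-- The events counted by orders are pairwise exclusive.
totalOrders≤n! : {L : List (SetPair k)} → AllPairs Cross L → totalOrders L ≤ k !
totalOrders≤n! [] = z≤n
-- A lone pair may have an empty first set, to which the recursion on first elements does not apply.
-- From two pairs on, crossing gives every first set an element.
totalOrders≤n! {L = (A , B) ∷ []} _ = ≤-trans (≤-reflexive (+-identityʳ _)) (orders≤n! A B)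
totalOrders≤n! {zero} {_ ∷ _ ∷ _} ((((() , _) , _) ∷ _) ∷ _)
totalOrders≤n! {suc k} {L@(_ ∷ _ ∷ _)} ps@(p@(((x , Ax , _) , _) ∷ _) ∷ _) = begin
  totalOrders L                                ≡⟨ totalOrders-restrict {L = L} ((x , Ax) ∷ All.map (λ (_ , y , Ay , _) → y , Ay) p) ⟩
  ∑[ x < suc k ] totalOrders (restrict x L)    ≤⟨ ∑-mono {suc k} (λ x → totalOrders≤n! (restrict-cross {x = x} ps)) ⟩
  ∑[ x < suc k ] (k !)                         ≡⟨ ∑-const (suc k) (k !) ⟩
  suc k !                                      ∎
  where open ≤-Reasoning

-- Upper bound

allPairs⁺ : ∀ {P : X → Set} {R : X → X → Set} → (∀ {x y} → P x → P y → x ≢ y → R x y) →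
            ∀ {xs} → Unique xs → All P xs → AllPairs R xs
allPairs⁺ r []       []       = []
allPairs⁺ r (u ∷ us) (p ∷ ps) = All.zipWith (λ (x≢y , py) → r p py x≢y) (u , ps) ∷ allPairs⁺ r us ps

sum-∑-comm : (f : X → Fin l → ℕ) (xs : List X) →
             sumᴸ (map (λ x → sum (f x)) xs) ≡ ∑[ p < l ] sumᴸ (map (λ x → f x p) xs)
sum-∑-comm {l = l} f [] = sym (∑-zero {l} {λ _ → 0} λ _ → refl)
sum-∑-comm f (x ∷ xs) = trans (cong (sum (f x) +_) (sum-∑-comm f xs)) (sym (∑-distrib-+ (f x) λ p → sumᴸ (map (λ x → f x p) xs)))

∈⇒≤sum : (f : X → ℕ) {x : X} {xs : List X} → x ∈ xs → f x ≤ sumᴸ (map f xs)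
∈⇒≤sum f (here refl) = m≤m+n _ _
∈⇒≤sum f (there x∈)  = ≤-trans (∈⇒≤sum f x∈) (m≤n+m _ _)

length*≤ : ∀ {c c′} {f : X → ℕ} {xs : List X} → All (λ x → c ≤ f x * c′) xs → length xs * c ≤ sumᴸ (map f xs) * c′
length*≤ [] = z≤n
length*≤ {c′ = c′} {f = f} {x ∷ xs} (p ∷ ps) =
  ≤-trans (+-mono-≤ p (length*≤ {f = f} ps)) (≤-reflexive (sym (*-distribʳ-+ c′ (f x) _)))

sum≤length* : ∀ {c} {f : X → ℕ} {xs : List X} → All (λ x → f x ≤ c) xs → sumᴸ (map f xs) ≤ length xs * c
sum≤length* []       = z≤n
sum≤length* (p ∷ ps) = +-mono-≤ p (sum≤length* ps)

<-of-sum : ∀ {r s t u} → 0 < u → r * t ≤ s * u → s < t → r < u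
<-of-sum {r} {s} {t} {u} 0<u rt≤su s<t = *-cancelʳ-< t r u
  (≤-<-trans rt≤su (<-≤-trans (*-monoˡ-< u {{>-nonZero 0<u}} s<t) (≤-reflexive (*-comm t u))))

SoleMeet : (f g : Fin l → Bool) → Fin l → Set
SoleMeet f g p = (f p ≡ true × g p ≡ true) × (∀ q → f q ≡ true → g q ≡ true → q ≡ p)

soleMeet? : ∀ (f g : Fin l → Bool) p → Dec (SoleMeet f g p)
soleMeet? f g p = ((f p Bool.≟ true) ×-dec (g p Bool.≟ true)) ×-dec
  all? λ q → (f q Bool.≟ true) →-dec ((g q Bool.≟ true) →-dec (q ≟ᶠ p))

meet-erase : ∀ {f g : Fin l → Bool} {p} → Meet f g → ¬ SoleMeet f g p → Meet (erase _≟ᶠ_ p f) g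
meet-erase {f = f} {g} {p} (q , fq , gq) notSole =
  decidable-stable (any? λ q → (erase _≟ᶠ_ p f q Bool.≟ true) ×-dec (g q Bool.≟ true)) λ none →
    let only : ∀ q → f q ≡ true → g q ≡ true → q ≡ p
        only q fq gq = decidable-stable (q ≟ᶠ p) λ q≢p → none (q , trans (erase-≢ _≟ᶠ_ f q≢p) fq , gq)
        q≡p = only q fq gq
    in notSole ((subst (λ q → f q ≡ true) q≡p fq , subst (λ q → g q ≡ true) q≡p gq) , only)

disjoint-erase : ∀ {f g : Fin l → Bool} {p} → SoleMeet f g p → Disjoint (erase _≟ᶠ_ p f) g
disjoint-erase {f = f} (_ , only) q e =
  Bool.¬-not λ gq → let q≢p , fq = erase⁻ _≟ᶠ_ f e in q≢p (only q fq gq)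

-- In use, `k` counts the vertices, `l` the edges, `S v` is the set of edges through `v`, and `e` is
-- the degree bound less one.
module CriticalCross
  {e : ℕ} (S : Fin k → Fin l → Bool) (A B : Fin k → Bool)
  (S≤ : ∀ v → # (S v) ≤ suc e)
  (meet : ∀ {a b} → A a ≡ true → B b ≡ true → Meet (S a) (S b))
  (critical : ∀ p → ∃₂ λ a b → (A a ≡ true × B b ≡ true) × SoleMeet (S a) (S b) p)
  (o : Fin k) (Ao : A o ≡ true) (Bo : B o ≡ true)
  where

  CoveredBy : (Fin k → Bool) → Fin l → Set
  CoveredBy U p = ∃₂ λ a b → (A a ≡ true × U b ≡ true) × SoleMeet (S a) (S b) p

  coveredBy? : ∀ U p → Dec (CoveredBy U p)
  coveredBy? U p = any? λ a → any? λ b → ((A a Bool.≟ true) ×-dec (U b Bool.≟ true)) ×-dec soleMeet? (S a) (S b) p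

  Covering : (Fin k → Bool) → Set
  Covering U = ∀ p → S o p ≡ false → CoveredBy U p

  covering? : ∀ U → Dec (Covering U)
  covering? U = all? λ p → (S o p Bool.≟ false) →-dec coveredBy? U p

  covering-mono : ∀ {U V} → U ⊑ V → Covering U → Covering V
  covering-mono U⊑V cov p op = let a , b , (Aa , Ub) , sole = cov p op in a , b , (Aa , U⊑V b Ub) , sole

  private
    minimal = minimise _≟ᶠ_ covering? covering-mono (allFin k) B (λ p _ → critical p)

  U : Fin k → Bool
  U = proj₁ minimal

  U⊑B : U ⊑ B
  U⊑B = proj₁ (proj₂ minimal)

  U-covering : Covering U
  U-covering = proj₁ (proj₂ (proj₂ minimal))

  -- A point outside S o for which b is indispensable in U, and the a which sees this.
  record Witness (b : Fin k) : Set where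
    field
      a     : Fin k
      p     : Fin l
      Aa    : A a ≡ true
      out   : S o p ≡ false
      sole  : SoleMeet (S a) (S b) p
      alone : ∀ {b′} → U b′ ≡ true → b ≢ b′ → ¬ SoleMeet (S a) (S b′) p

  -- By minimality, erasing `b` uncovers some `p` outside `S o`. A pair covering `p` in `U` must
  -- then use `b`, and no other `b′` in `U` can replace it.
  witness : ∀ {b} → U b ≡ true → Witness b
  witness {b} Ub
    with p , ¬imp ← ¬∀⟶∃¬ l _ (λ p → (S o p Bool.≟ false) →-dec coveredBy? (erase _≟ᶠ_ b U) p)
                      (proj₂ (proj₂ (proj₂ minimal)) (∈-allFin b) Ub)
    with S o p in op
  ... | true  = contradiction (λ ()) ¬imp
  ... | false with U-covering p op
  ...   | a , b″ , (Aa , Ub″) , sole with b″ ≟ᶠ b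
  ...     | no b″≢b  = contradiction (λ _ → a , b″ , (Aa , trans (erase-≢ _≟ᶠ_ U b″≢b) Ub″) , sole) ¬imp
  ...     | yes refl = record
    { a = a; p = p; Aa = Aa; out = op; sole = sole
    ; alone = λ {b′} Ub′ b≢b′ sole′ →
        ¬imp λ _ → a , b′ , (Aa , trans (erase-≢ _≟ᶠ_ U (b≢b′ ∘ sym)) Ub′) , sole′ }

  first : Fin k → Fin l → Bool
  first b with U b Bool.≟ true
  ... | yes Ub = let open Witness (witness Ub) in erase _≟ᶠ_ p (S a)
  -- A dummy value; only members of `U` enter `setPairs`.
  ... | no _   = λ _ → false

  first-witness : ∀ {b} → U b ≡ true → Σ (Witness b) λ w → first b ≡ erase _≟ᶠ_ (Witness.p w) (S (Witness.a w))
  first-witness {b} Ub with U b Bool.≟ true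
  ... | yes Ub′ = witness Ub′ , refl
  ... | no ¬Ub  = contradiction Ub ¬Ub

  first-disjoint : ∀ {b} → U b ≡ true → Disjoint (first b) (S b)
  first-disjoint Ub with w , eq ← first-witness Ub rewrite eq = disjoint-erase (Witness.sole w)

  first-size : ∀ {b} → U b ≡ true → # (first b) ≤ e
  first-size Ub with w , eq ← first-witness Ub rewrite eq =
    ≤-pred (≤-trans (≤-reflexive (#-erase (S a) (proj₁ (proj₁ sole)))) (S≤ a))
    where open Witness w

  -- `S a` meets `S b′`, and by `alone` not in `p` only; so a common point survives the deletion of
  -- `p`.
  first-meets : ∀ {b b′} → U b ≡ true → U b′ ≡ true → b ≢ b′ → Meet (first b) (S b′)
  first-meets Ub Ub′ b≢b′ with w , eq ← first-witness Ub rewrite eq =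
    meet-erase (meet Aa (U⊑B _ Ub′)) (alone Ub′ b≢b′)
    where open Witness w

  first-meets-o : ∀ {b} → U b ≡ true → Meet (first b) (S o)
  first-meets-o Ub with w , eq ← first-witness Ub rewrite eq =
    meet-erase (meet Aa Bo) λ ((_ , op) , _) → true≢false (trans (sym op) out)
    where open Witness w

  outside-o : ∀ {b} → U b ≡ true → Meet (not ∘ S o) (S b)
  outside-o Ub = let open Witness (witness Ub) in p , cong not out , proj₂ (proj₁ sole)

  members : List (Fin k)
  members = filter (λ b → U b Bool.≟ true) (allFin k)

  members-U : All (λ b → U b ≡ true) members
  members-U = All.all-filter _ (allFin k)

  setPairs : List (SetPair l)
  setPairs = map (λ b → first b , S b) members

  setPairs-cross : AllPairs Cross ((not ∘ S o , S o) ∷ setPairs)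
  setPairs-cross =
    All.map⁺ (All.map (λ Ub → outside-o Ub , first-meets-o Ub) members-U) ∷
    AllPairs.map⁺ (allPairs⁺ (λ Ub Ub′ b≢b′ → first-meets Ub Ub′ b≢b′ , first-meets Ub′ Ub (b≢b′ ∘ sym))
                              (filter⁺ _ (allFin⁺ k)) members-U)

  -- C(2d - 1, d) for d = e + 1, written through the size bounds `e` for `first b` and `suc e` for
  -- `S b`.
  N : ℕ
  N = (e + suc e) C suc e

  -- Each member of `U` accounts for at least l! / N orders of the edges. The extra pair claims at
  -- least one further order, so the members together have fewer than l!.
  members-< : length members < N
  members-< = <-of-sum N>0 (length*≤ {f = f} (All.map bound members-U))
    (subst (_< l !) (cong sumᴸ (sym (map-∘ members))) T<m!)
    where
    f : Fin k → ℕ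
    f b = orders (first b) (S b)
    bound : ∀ {b} → U b ≡ true → l ! ≤ f b * N
    bound Ub = n!≤orders*binomial (first _) (S _) (first-disjoint Ub) (first-size Ub) (S≤ _)
    N>0 : 0 < N
    N>0 = [c+b]C[b]-mono {0} {e} {0} {suc e} z≤n z≤n
    T<m! : totalOrders setPairs < l !
    T<m! = ≤-trans (+-monoˡ-≤ (totalOrders setPairs) (orders-positive (not ∘ S o) (S o) λ x → Bool.not-injective {_} {false}))
                   (totalOrders≤n! setPairs-cross)

  outside : Fin k → Fin l → Bool
  outside b p = S b p ∧ not (S o p)

  outside-size : ∀ {b} → U b ≡ true → # (outside b) ≤ e
  outside-size {b} Ub with q , oq , bq ← meet Ao (U⊑B b Ub) = ≤-pred (begin
    suc (# (outside b))            ≤⟨ s≤s (#-mono sub) ⟩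
    suc (# (erase _≟ᶠ_ q (S b)))   ≡⟨ #-erase (S b) bq ⟩
    # (S b)                        ≤⟨ S≤ b ⟩
    suc e                          ∎)
    where
    open ≤-Reasoning
    sub : outside b ⊑ erase _≟ᶠ_ q (S b)
    sub p h with bp , op ← ∧-true (S b p) _ h =
      trans (erase-≢ _≟ᶠ_ (S b) λ { refl → true≢false (trans (sym op) (cong not oq)) }) bp

  covered : ∀ p → 1 ≤ ⟦ S o p ⟧ + sumᴸ (map (λ b → ⟦ outside b p ⟧) members)
  covered p with S o p in op
  ... | true  = s≤s z≤n
  ... | false with a , b , (_ , Ub) , ((_ , bp) , _) ← U-covering p op = begin
    1                                                          ≡⟨ cong (λ s → ⟦ s ∧ true ⟧) bp ⟨
    ⟦ S b p ∧ true ⟧                                           ≤⟨ ∈⇒≤sum (λ b → ⟦ S b p ∧ true ⟧) (∈-filter⁺ _ (∈-allFin b) Ub) ⟩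
    sumᴸ (map (λ b → ⟦ S b p ∧ true ⟧) members)               ∎
    where open ≤-Reasoning

  m≤ : l ≤ e * N + 1
  m≤ = begin
    l                                                                             ≡⟨ #-true l ⟨
    ∑[ p < l ] 1                                                                  ≤⟨ ∑-mono covered ⟩
    ∑[ p < l ] (⟦ S o p ⟧ + sumᴸ (map (λ b → ⟦ outside b p ⟧) members))           ≡⟨ ∑-distrib-+ (⟦_⟧ ∘ S o) (λ p → sumᴸ (map (λ b → ⟦ outside b p ⟧) members)) ⟩
    # (S o) + ∑[ p < l ] sumᴸ (map (λ b → ⟦ outside b p ⟧) members)               ≡⟨ cong (# (S o) +_) (sum-∑-comm (λ b p → ⟦ outside b p ⟧) members) ⟨
    # (S o) + sumᴸ (map (λ b → # (outside b)) members)                            ≤⟨ +-mono-≤ (S≤ o) (sum≤length* {f = # ∘ outside} (All.map outside-size members-U)) ⟩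
    suc e + length members * e                                                    ≡⟨ regroup e (length members) ⟩
    -- By strictness `suc (length members)` is still at most `N`; the spare summand `e` pays for all
    -- of `S o` but one point.
    e * suc (length members) + 1                                                  ≤⟨ +-monoˡ-≤ 1 (*-monoʳ-≤ e members-<) ⟩
    e * N + 1                                                                     ∎
    where
    open ≤-Reasoning
    regroup : ∀ e k → suc e + k * e ≡ e * suc k + 1
    regroup = solve-∀

-- Incidence and the application of Hall's theorem

incident : (H : Hypergraph) → Fin (n H) → Fin (m H) → Bool
incident H x i = lookup (edge H i) x

length-filter-tabulate : ∀ {P : X → Set} (P? : Decidable P) (f : Fin k → X) →
                         length (filter P? (tabulate f)) ≡ # (does ∘ P? ∘ f)
length-filter-tabulate {k = zero}  P? f = refl
length-filter-tabulate {k = suc k} P? f with does (P? (f zero))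
... | true  = cong suc (length-filter-tabulate P? (f ∘ suc))
... | false = length-filter-tabulate P? (f ∘ suc)

does-∈? : ∀ (x : Fin k) p → does (x ∈ˢ? p) ≡ lookup p x
does-∈? x p with x ∈ˢ? p
... | yes x∈p = sym ([]=⇒lookup x∈p)
... | no  x∉p = sym (Bool.¬-not (x∉p ∘ lookup⇒[]= x p))

degree≡# : ∀ H x → degree H x ≡ # (incident H x)
degree≡# H x = trans (length-filter-tabulate (λ i → x ∈ˢ? edge H i) (λ i → i))
                     (sum-cong-≗ λ i → cong ⟦_⟧ (does-∈? x (edge H i)))

-- The moves open to an inverting permutation: `H` is invertible exactly when this relation contains
-- the graph of a permutation.
separated : (H : Hypergraph) → Rel (n H)
separated H (x , y) = not (does (any? λ i → (incident H x i Bool.≟ true) ×-dec (incident H y i Bool.≟ true)))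

separated-false : ∀ H {x y} → separated H (x , y) ≡ false → Meet (incident H x) (incident H y)
separated-false H {x} {y} e with any? (λ i → (incident H x i Bool.≟ true) ×-dec (incident H y i Bool.≟ true))
... | yes meet = meet

separated-true : ∀ H {x y} → separated H (x , y) ≡ true → ¬ Meet (incident H x) (incident H y)
separated-true H {x} {y} e with any? (λ i → (incident H x i Bool.≟ true) ×-dec (incident H y i Bool.≟ true))
... | no ¬meet = ¬meet

¬Invertible⇒Barrier : ∀ H → ¬ Invertible H → Barrier (separated H)
¬Invertible⇒Barrier H ¬inv = decidable-stable (barrier? (separated H)) λ noBar →
  let π , sep = hall (separated H) noBar in
  ¬inv (π , λ i _ x x∈ πx∈ → separated-true H (sep x) (i , []=⇒lookup x∈ , []=⇒lookup πx∈))

-- The permutation inverting `H` without `p` still maps some `a` in `A` into `B`. This `a` and its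
-- image share an edge, and every edge but `p` is excluded.
sole-incidence : ∀ H → (∀ j → InvertibleWithout H j) → ∀ {A B} → n H < # A + # B →
                 (∀ {a b} → A a ≡ true → B b ≡ true → Meet (incident H a) (incident H b)) →
                 ∀ p → ∃₂ λ a b → (A a ≡ true × B b ≡ true) × SoleMeet (incident H a) (incident H b) p
sole-incidence H inv size meet p =
  let π , ok = inv p
      a , Aa , Bb = permutation-meets π size
      only : ∀ q → incident H a q ≡ true → incident H (π ⟨$⟩ʳ a) q ≡ true → q ≡ p
      only q aq bq = decidable-stable (q ≟ᶠ p) λ q≢p → ok q q≢p a (lookup⇒[]= a _ aq) (lookup⇒[]= (π ⟨$⟩ʳ a) _ bq)
      q , aq , bq = meet Aa Bb
      q≡p = only q aq bq
  in a , π ⟨$⟩ʳ a , (Aa , Bb) ,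
     ((subst (λ q → incident H a q ≡ true) q≡p aq , subst (λ q → incident H (π ⟨$⟩ʳ a) q ≡ true) q≡p bq) , only)

upper-bound : ∀ H e → InvertibilityCritical H → OfDegree (suc e) H →
              edgeCount H ≤ e * ((e + suc e) C suc e) + 1
upper-bound H e (¬inv , inv) deg =
  let A , B , size , joined = ¬Invertible⇒Barrier H ¬inv
      -- The identity permutation turns the size bound into a common vertex of `A` and `B`.
      o , Ao , Bo = permutation-meets idₚ size
      meet : ∀ {a b} → A a ≡ true → B b ≡ true → Meet (incident H a) (incident H b)
      meet Aa Bb = separated-false H (joined _ _ Aa Bb)
  in CriticalCross.m≤ {e = e} (incident H) A B (λ v → ≤-trans (≤-reflexive (sym (degree≡# H v))) (deg v))
      meet (sole-incidence H inv size meet) o Ao Bo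

-- Lower bound

#≤length : (xs : List (Fin k)) (f : Fin k → Bool) → (∀ x → f x ≡ true → x ∈ xs) → # f ≤ length xs
#≤length []       f f⊆ = ≤-reflexive (#-empty λ (x , fx) → contradiction (f⊆ x fx) λ ())
#≤length (x ∷ xs) f f⊆ with f x in fx
... | true  = ≤-trans (≤-reflexive (sym (#-erase f fx))) (s≤s (#≤length xs (erase _≟ᶠ_ x f) λ y e →
  let y≢x , fy = erase⁻ _≟ᶠ_ f e in Any.tail y≢x (f⊆ y fy)))
... | false = m≤n⇒m≤1+n (#≤length xs f λ y fy →
  Any.tail (λ { refl → true≢false (trans (sym fy) fx) }) (f⊆ y fy))

-- Critical hypergraphs from intersecting families

module FromIntersecting
  (q l : ℕ) (F : Fin (suc q) → Fin l → Bool)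
  (meet : ∀ z z′ → Meet (F z) (F z′))
  (critical : ∀ i → ∃₂ λ z z′ → SoleMeet (F z) (F z′) i)
  where

  Vertex : Set
  Vertex = Fin (suc q) ⊎ Fin q

  inEdge : Fin l → Vertex → Bool
  inEdge i = [ (λ z → F z i) , (λ _ → false) ]′

  edgeOf : Fin l → Subset (suc q + q)
  edgeOf i = Vec.tabulate (inEdge i ∘ splitAt (suc q))

  lookup-edge : ∀ i v → lookup (edgeOf i) (join (suc q) q v) ≡ inEdge i v
  lookup-edge i v = trans (lookup∘tabulate (inEdge i ∘ splitAt (suc q)) (join (suc q) q v)) (cong (inEdge i) (splitAt-join (suc q) q v))

  edgeOf-injective : ∀ {i j} → edgeOf i ≡ edgeOf j → i ≡ j
  edgeOf-injective {i} {j} eq with z , z′ , (zi , z′i) , only ← critical i =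
    sym (only j (trans (sym (same z)) zi) (trans (sym (same z′)) z′i))
    where
    same : ∀ z → F z i ≡ F z j
    same z = trans (sym (lookup-edge i (inj₁ z)))
                   (trans (cong (λ E → lookup E (join (suc q) q (inj₁ z))) eq) (lookup-edge j (inj₁ z)))

  H : Hypergraph
  H = record { n = suc q + q ; m = l ; edge = edgeOf ; edge-injective = edgeOf-injective }

  -- Any two members, equal ones included, share an edge, so an inverting permutation would send all
  -- q + 1 of them injectively to the q isolated vertices.
  notInvertible : ¬ Invertible H
  notInvertible (π , avoid) = 1+n≰n (injective⇒≤ {f = proj₁ ∘ image} image-injective)
    where
    image : ∀ z → ∃ λ y → π ⟨$⟩ʳ (z ↑ˡ q) ≡ suc q ↑ʳ y
    image z with splitAt (suc q) (π ⟨$⟩ʳ (z ↑ˡ q)) in eq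
    ... | inj₂ y  = y , sym (splitAt⁻¹-↑ʳ {suc q} {q} {π ⟨$⟩ʳ (z ↑ˡ q)} eq)
    ... | inj₁ z′ with i , zi , z′i ← meet z z′ =
      contradiction (lookup⇒[]= _ _ (trans (cong (lookup (edgeOf i)) (sym (splitAt⁻¹-↑ˡ {suc q} {q} {π ⟨$⟩ʳ (z ↑ˡ q)} eq)))
                                           (trans (lookup-edge i (inj₁ z′)) z′i)))
                    (avoid i tt (z ↑ˡ q) (lookup⇒[]= _ _ (trans (lookup-edge i (inj₁ z)) zi)))
    image-injective : ∀ {z z′} → proj₁ (image z) ≡ proj₁ (image z′) → z ≡ z′
    image-injective {z} {z′} eq = ↑ˡ-injective q z z′ (Injection.injective (Inverse⇒Injection π)
      (trans (proj₂ (image z)) (trans (cong (suc q ↑ʳ_) eq) (sym (proj₂ (image z′))))))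

  -- The move from `z` to `z′` is the only one between members; all others start or end in an
  -- isolated vertex, which lies on no edge. So only common edges of `z` and `z′` obstruct, and
  -- exchanging `z` with `z′` gives the inverse.
  swap : (z z′ : Fin (suc q)) → Vertex → Vertex
  swap z z′ (inj₁ u) with z ≟ᶠ u
  ... | yes _  = inj₁ z′
  ... | no z≢u = inj₂ (punchOut z≢u)
  swap z z′ (inj₂ y) = inj₁ (punchIn z′ y)

  swap-swap : ∀ z z′ v → swap z′ z (swap z z′ v) ≡ v
  swap-swap z z′ (inj₁ u) with z ≟ᶠ u
  ... | no z≢u = cong inj₁ (punchIn-punchOut z≢u)
  ... | yes refl with z′ ≟ᶠ z′
  ...   | yes _ = refl
  ...   | no ≢  = contradiction refl ≢
  swap-swap z z′ (inj₂ y) with z′ ≟ᶠ punchIn z′ y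
  ... | yes eq = contradiction (sym eq) (punchInᵢ≢i z′ y)
  ... | no ≢   = cong inj₂ (trans (punchOut-cong z′ refl) (punchOut-punchIn z′))

  π : (z z′ : Fin (suc q)) → Permutation′ (suc q + q)
  π z z′ = permutation (lift z z′) (lift z′ z) (inverse z′ z) (inverse z z′)
    where
    lift : ∀ z z′ → Fin (suc q + q) → Fin (suc q + q)
    lift z z′ = join (suc q) q ∘ swap z z′ ∘ splitAt (suc q)
    inverse : ∀ z z′ x → lift z′ z (lift z z′ x) ≡ x
    inverse z z′ x = trans (cong (join (suc q) q ∘ swap z′ z) (splitAt-join (suc q) q (swap z z′ (splitAt (suc q) x))))
      (trans (cong (join (suc q) q) (swap-swap z z′ (splitAt (suc q) x))) (join-splitAt (suc q) q x))

  invertibleWithout : ∀ j → InvertibleWithout H j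
  invertibleWithout j with z , z′ , _ , only ← critical j =
    π z z′ , λ i i≢j x x∈ πx∈ → i≢j (conflict i (splitAt (suc q) x)
      (trans (sym (lookup∘tabulate (inEdge i ∘ splitAt (suc q)) x)) ([]=⇒lookup x∈))
      (trans (sym (lookup-edge i (swap z z′ (splitAt (suc q) x)))) ([]=⇒lookup πx∈)))
    where
    conflict : ∀ i v → inEdge i v ≡ true → inEdge i (swap z z′ v) ≡ true → i ≡ j
    conflict i (inj₁ u) ui wi with z ≟ᶠ u
    ... | yes refl = only i ui wi

  ofDegree : ∀ {d} → (∀ z → # (F z) ≤ d) → OfDegree d H
  ofDegree {d} F≤ x = begin
    degree H x                               ≡⟨ degree≡# H x ⟩
    # (incident H x)                         ≡⟨ sum-cong-≗ (λ i → cong ⟦_⟧ (lookup∘tabulate (inEdge i ∘ splitAt (suc q)) x)) ⟩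
    # (λ i → inEdge i (splitAt (suc q) x))   ≤⟨ bound (splitAt (suc q) x) ⟩
    d                                        ∎
    where
    open ≤-Reasoning
    bound : ∀ v → # (λ i → inEdge i v) ≤ d
    bound (inj₁ z) = F≤ z
    bound (inj₂ y) = ≤-trans (≤-reflexive (∑-zero {l} λ _ → refl)) z≤n

Sole : (xs ys : List X) → X → Set
Sole xs ys p = (p ∈ xs × p ∈ ys) × (∀ r → r ∈ xs → r ∈ ys → r ≡ p)

CriticalOfDegree : ℕ → ℕ → Set
CriticalOfDegree d l = Σ Hypergraph λ H → InvertibilityCritical H × OfDegree d H × edgeCount H ≡ l

fromLists : ∀ {Z P : Set} {q l d} → Fin (suc q) ↔ Z → Fin l ↔ P → (L : Z → List P) →
            (∀ z → length (L z) ≤ d) →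
            (∀ z z′ → ∃ λ p → p ∈ L z × p ∈ L z′) →
            (∀ p → ∃₂ λ z z′ → Sole (L z) (L z′) p) →
            CriticalOfDegree d l
fromLists {Z} {P} {q} {l} {d} eZ eP L L≤ meets sole = H , (notInvertible , invertibleWithout) , ofDegree F≤ , refl
  where
  module Z = Inverse eZ
  module P = Inverse eP
  codes : Fin (suc q) → List (Fin l)
  codes z = map P.from (L (Z.to z))
  open DecMembership (_≟ᶠ_ {l}) using (_∈?_)
  F : Fin (suc q) → Fin l → Bool
  F z i = does (i ∈? codes z)
  F⁻ : ∀ z i → F z i ≡ true → i ∈ codes z
  F⁻ z i e with i ∈? codes z
  ... | yes i∈ = i∈
  ∈⇒F : ∀ {z p} → p ∈ L z → F (Z.from z) (P.from p) ≡ true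
  ∈⇒F {z} {p} p∈ = dec-true (_ ∈? _) (∈-map⁺ P.from (subst (λ z → p ∈ L z) (sym (Z.strictlyInverseˡ z)) p∈))
  F⇒∈ : ∀ {z i} → F (Z.from z) i ≡ true → P.to i ∈ L z
  F⇒∈ {z} {i} e with p , p∈ , refl ← ∈-map⁻ P.from (F⁻ _ i e) =
    subst (_∈ L z) (sym (P.strictlyInverseˡ p)) (subst (λ z → p ∈ L z) (Z.strictlyInverseˡ z) p∈)
  F≤ : ∀ z → # (F z) ≤ d
  F≤ z = ≤-trans (#≤length (codes z) (F z) (F⁻ z)) (≤-trans (≤-reflexive (length-map P.from (L (Z.to z)))) (L≤ (Z.to z)))
  meet : ∀ z z′ → Meet (F z) (F z′)
  meet z z′ with p , p∈ , p∈′ ← meets (Z.to z) (Z.to z′) =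
    P.from p , dec-true (_ ∈? _) (∈-map⁺ P.from p∈) , dec-true (_ ∈? _) (∈-map⁺ P.from p∈′)
  critical : ∀ i → ∃₂ λ z z′ → SoleMeet (F z) (F z′) i
  critical i with z , z′ , (p∈ , p∈′) , only ← sole (P.to i) =
    Z.from z , Z.from z′ , (at p∈ , at p∈′) ,
    λ j e e′ → trans (sym (P.strictlyInverseʳ j)) (trans (cong P.from (only (P.to j) (F⇒∈ e) (F⇒∈ e′))) (P.strictlyInverseʳ i))
    where
    at : ∀ {z} → P.to i ∈ L z → F (Z.from z) i ≡ true
    at {z} p∈ = subst (λ i → F (Z.from z) i ≡ true) (P.strictlyInverseʳ i) (∈⇒F p∈)
  open FromIntersecting q l F meet critical

-- half k false and half k true will be cross-intersecting; (b , inj₁ tt) is the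
-- new point of the copy b.
Point Index : ℕ → Set
Point zero    = ⊤
Point (suc k) = Bool × (⊤ ⊎ Point k)
Index zero    = ⊤
Index (suc k) = Bool × Index k

half : ∀ k → Bool → Index k → List (Point k)
half zero    c _       = tt ∷ []
-- The colour `c` flips the copy of the new point. Sets of opposite colours thus share their new
-- point if their `b` differ; if these agree, the new points differ and the sets meet inside the
-- copy.
half (suc k) c (b , s) = (b xor c , inj₁ tt) ∷ map (λ p → b , inj₂ p) (half k c s)

length-half : ∀ k c s → length (half k c s) ≡ suc k
length-half zero    c s       = refl
length-half (suc k) c (b , s) = cong suc (trans (length-map _ (half k c s)) (length-half k c s))

half-new⁻ : ∀ {k c b s a} → (a , inj₁ tt) ∈ half (suc k) c (b , s) → a ≡ b xor c
half-new⁻ (here refl) = refl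
half-new⁻ {k} {c} {b} {s} (there p∈) with _ , _ , () ← ∈-map⁻ (λ p → b , inj₂ p) p∈

half-copy⁻ : ∀ {k c b s a p} → (a , inj₂ p) ∈ half (suc k) c (b , s) → a ≡ b × p ∈ half k c s
half-copy⁻ {k} {c} {b} {s} (there p∈) with _ , p∈′ , refl ← ∈-map⁻ (λ p → b , inj₂ p) p∈ = refl , p∈′

half-copy⁺ : ∀ {k c b s p} → p ∈ half k c s → (b , inj₂ p) ∈ half (suc k) c (b , s)
half-copy⁺ p∈ = there (∈-map⁺ _ p∈)

half-cross : ∀ k s t → ∃ λ p → p ∈ half k false s × p ∈ half k true t
half-cross zero    s t = tt , here refl , here refl
half-cross (suc k) (true  , s) (false , t) = _ , here refl , here refl
half-cross (suc k) (false , s) (true  , t) = _ , here refl , here refl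
half-cross (suc k) (true  , s) (true  , t) = let p , p∈ , p∈′ = half-cross k s t in _ , half-copy⁺ p∈ , half-copy⁺ p∈′
half-cross (suc k) (false , s) (false , t) = let p , p∈ , p∈′ = half-cross k s t in _ , half-copy⁺ p∈ , half-copy⁺ p∈′

origin : ∀ k → Index k
origin zero    = tt
origin (suc k) = true , origin k

-- To isolate a new point, take sets in different copies, which have no old point in common; to
-- isolate an old point, take sets in its own copy, whose new points differ.
half-sole : ∀ k p → ∃₂ λ s t → Sole (half k false s) (half k true t) p
half-sole zero tt = tt , tt , (here refl , here refl) , λ _ _ _ → refl
half-sole (suc k) (b , inj₁ tt) =
  (b , origin k) , (not b , origin k) ,
  (here (cong (_, inj₁ tt) (b≡b b)) , here (cong (_, inj₁ tt) (b≡¬¬b b))) ,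
  λ { (a , inj₁ tt) r∈ _   → cong (_, inj₁ tt) (trans (half-new⁻ r∈) (sym (b≡b b)))
    ; (a , inj₂ p)  r∈ r∈′ → contradiction (trans (sym (proj₁ (half-copy⁻ r∈))) (proj₁ (half-copy⁻ r∈′))) (Bool.not-¬ refl) }
  where
  b≡b : ∀ b → b ≡ b xor false
  b≡b true  = refl
  b≡b false = refl
  b≡¬¬b : ∀ b → b ≡ not b xor true
  b≡¬¬b true  = refl
  b≡¬¬b false = refl
half-sole (suc k) (b , inj₂ p) with s , t , (p∈ , p∈′) , only ← half-sole k p =
  (b , s) , (b , t) , (half-copy⁺ p∈ , half-copy⁺ p∈′) ,
  λ { (a , inj₁ tt) r∈ r∈′ → contradiction (trans (sym (half-new⁻ r∈)) (half-new⁻ r∈′)) (different b)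
    ; (a , inj₂ p)  r∈ r∈′ → cong₂ (λ a p → a , inj₂ p) (proj₁ (half-copy⁻ r∈))
                                (only p (proj₂ (half-copy⁻ r∈)) (proj₂ (half-copy⁻ r∈′))) }
  where
  different : ∀ b → b xor false ≢ b xor true
  different true  ()
  different false ()

-- The points inj₁ c make each of the two families intersecting.
Family : ∀ k → Bool × Index k → List (Bool ⊎ Point k)
Family k (c , s) = inj₁ c ∷ map inj₂ (half k c s)

Family-marker⁻ : ∀ {k a c s} → inj₁ a ∈ Family k (c , s) → a ≡ c
Family-marker⁻ (here refl) = refl
Family-marker⁻ (there p∈) with _ , _ , () ← ∈-map⁻ inj₂ p∈

Family-point⁻ : ∀ {k p c s} → inj₂ p ∈ Family k (c , s) → p ∈ half k c s
Family-point⁻ (there p∈) with _ , p∈′ , refl ← ∈-map⁻ inj₂ p∈ = p∈′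

Family-point⁺ : ∀ {k p c s} → p ∈ half k c s → inj₂ p ∈ Family k (c , s)
Family-point⁺ p∈ = there (∈-map⁺ inj₂ p∈)

Family-meets : ∀ k z z′ → ∃ λ p → p ∈ Family k z × p ∈ Family k z′
Family-meets k (true  , s) (true  , t) = _ , here refl , here refl
Family-meets k (false , s) (false , t) = _ , here refl , here refl
Family-meets k (false , s) (true  , t) = let p , p∈ , p∈′ = half-cross k s t in _ , Family-point⁺ p∈ , Family-point⁺ p∈′
Family-meets k (true  , s) (false , t) = let p , p∈ , p∈′ = half-cross k t s in _ , Family-point⁺ p∈′ , Family-point⁺ p∈

-- A marker is isolated by two sets of one colour in different copies, whose halves are disjoint;
-- this takes a doubling step, whence `suc k`. A point is isolated by sets of opposite colours,
-- whose markers differ.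
Family-sole : ∀ k p → ∃₂ λ z z′ → Sole (Family (suc k) z) (Family (suc k) z′) p
Family-sole k (inj₁ c) =
  (c , true , origin k) , (c , false , origin k) , (here refl , here refl) ,
  λ { (inj₁ a) r∈ _   → cong inj₁ (Family-marker⁻ r∈)
    ; (inj₂ p) r∈ r∈′ → ⊥-elim (disjoint p (Family-point⁻ r∈) (Family-point⁻ r∈′)) }
  where
  disjoint : ∀ p → p ∈ half (suc k) c (true , origin k) → p ∈ half (suc k) c (false , origin k) → ⊥
  disjoint (a , inj₁ tt) r∈ r∈′ = Bool.not-¬ refl (trans (sym (half-new⁻ r∈′)) (half-new⁻ r∈))
  disjoint (a , inj₂ p)  r∈ r∈′ = true≢false (trans (sym (proj₁ (half-copy⁻ r∈))) (proj₁ (half-copy⁻ r∈′)))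
Family-sole k (inj₂ p) with s , t , (p∈ , p∈′) , only ← half-sole (suc k) p =
  (false , s) , (true , t) , (Family-point⁺ p∈ , Family-point⁺ p∈′) ,
  λ { (inj₁ a) r∈ r∈′ → contradiction (trans (sym (Family-marker⁻ r∈′)) (Family-marker⁻ r∈)) true≢false
    ; (inj₂ r) r∈ r∈′ → cong inj₂ (only r (Family-point⁻ r∈) (Family-point⁻ r∈′)) }

-- The number of edges and the small degrees

#Point : ℕ → ℕ
#Point zero    = 1
#Point (suc k) = 2 * (1 + #Point k)

#Point+2 : ∀ k → #Point k + 2 ≡ 3 * 2 ^ k
#Point+2 zero    = refl
#Point+2 (suc k) = begin
  2 * (1 + #Point k) + 2  ≡⟨ regroup (#Point k) ⟩
  2 * (#Point k + 2)      ≡⟨ cong (2 *_) (#Point+2 k) ⟩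
  2 * (3 * 2 ^ k)         ≡⟨ regroup′ (2 ^ k) ⟩
  3 * 2 ^ suc k           ∎
  where
  open ≡-Reasoning
  regroup : ∀ p → 2 * (1 + p) + 2 ≡ 2 * (p + 2)
  regroup = solve-∀
  regroup′ : ∀ p → 2 * (3 * p) ≡ 3 * (2 * p)
  regroup′ = solve-∀

Point↔ : ∀ k → Fin (#Point k) ↔ Point k
Point↔ zero    = 1↔⊤
Point↔ (suc k) = ↔-trans *↔× (2↔Bool ×-↔ ↔-trans (+↔⊎ {1}) (1↔⊤ ⊎-↔ Point↔ k))

Index↔ : ∀ k → Fin (2 ^ k) ↔ Index k
Index↔ zero    = 1↔⊤
Index↔ (suc k) = ↔-trans *↔× (2↔Bool ×-↔ Index↔ k)

-- With d = k + 3, a member consists of its marker and the k + 2 points of its half, and the number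
-- of edges is 2 + (3·2^(k+1) - 2) = 3·2^(d-2).
family-hypergraph : ∀ k → CriticalOfDegree (3 + k) (2 + #Point (suc k))
family-hypergraph k = fromLists
  -- The 2^(k+2) members have to be counted by a successor `suc q`, `q` being the number of isolated
  -- vertices.
  (subst (λ s → Fin s ↔ (Bool × Index (suc k))) (sym (suc-pred (2 ^ (2 + k)) {{m^n≢0 2 (2 + k)}})) (Index↔ (2 + k)))
  (↔-trans +↔⊎ (2↔Bool ⊎-↔ Point↔ (suc k)))
  (Family (suc k))
  (λ (c , s) → ≤-reflexive (cong suc (trans (length-map inj₂ (half (suc k) c s)) (length-half (suc k) c s))))
  (Family-meets (suc k))
  (Family-sole k)

single-edge : ∀ d → 1 ≤ d → CriticalOfDegree d 1
single-edge d 1≤d = fromLists 1↔⊤ 1↔⊤ (λ _ → tt ∷ []) (λ _ → 1≤d)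
  (λ _ _ → tt , here refl , here refl) (λ _ → tt , tt , (here refl , here refl) , λ _ _ _ → refl)

-- Multiplying 3·2^(d-2) - 2 ≤ m by 4 and moving the subtracted term across frees the bound of
-- negative exponents and truncated subtraction.
lower-bound : ∀ d → 1 ≤ d →
  Σ Hypergraph λ H → InvertibilityCritical H × OfDegree d H × 3 * 2 ^ d ≤ 4 * (edgeCount H + 2)
-- For d ≤ 2 the bound asks for at most one edge.
lower-bound 1 1≤d = let H , crit , deg , count = single-edge 1 1≤d in
  H , crit , deg , ≤-trans (m≤m+n 6 6) (≤-reflexive (cong (λ l → 4 * (l + 2)) (sym count)))
lower-bound 2 1≤d = let H , crit , deg , count = single-edge 2 1≤d in
  H , crit , deg , ≤-reflexive (cong (λ l → 4 * (l + 2)) (sym count))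
lower-bound (suc (suc (suc k))) _ = let H , crit , deg , count = family-hypergraph k in
  H , crit , deg , (begin
    3 * 2 ^ (3 + k)                ≡⟨ regroup (2 ^ suc k) ⟩
    4 * (3 * 2 ^ suc k)            ≡⟨ cong (4 *_) (#Point+2 (suc k)) ⟨
    -- The construction has two edges more than the bound asks for.
    4 * (#Point (suc k) + 2)       ≤⟨ *-monoʳ-≤ 4 (m≤n+m (#Point (suc k) + 2) 2) ⟩
    4 * (2 + #Point (suc k) + 2)   ≡⟨ cong (λ l → 4 * (l + 2)) count ⟨
    4 * (edgeCount H + 2)          ∎)
  where
  open ≤-Reasoning
  regroup : ∀ p → 3 * (2 * (2 * p)) ≡ 4 * (3 * p)
  regroup = solve-∀

theorem1p1 : (d : ℕ) → 1 ≤ d →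
    Σ Hypergraph (λ H → InvertibilityCritical H × OfDegree d H
    × 3 * 2 ^ d ≤ 4 * (edgeCount H + 2))
    × ((H : Hypergraph) → InvertibilityCritical H → OfDegree d H →
    edgeCount H ≤ (d ∸ 1) * ((2 * d ∸ 1) C d) + 1)
theorem1p1 (suc e) 1≤d =
  lower-bound (suc e) 1≤d ,
  -- For d = suc e, `2 * d ∸ 1` computes to `e + suc (e + 0)`; the substitution accounts for the
  -- zero.
  λ H crit deg → subst (λ c → edgeCount H ≤ e * ((e + suc c) C suc e) + 1) (sym (+-identityʳ e))
                       (upper-bound H e crit deg)
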